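{- There exists a digraph $D=\langle V,E\rangle$ with countable vertex set $V$ such that $N(u)$ is finite for every $u\in V$ and for every finite set $A\subseteq V$ there exists a vertex $u\in V$ with $N(u)=A$. In particular, $D$ is strongly extensive.
   Context: A digraph is $D=\langle V,E\rangle$ with $V$ a nonempty set and $E\subseteq V\times V$. $N(u)=\{v\in V:\langle v,u\rangle\in E\}$ is the set of in-neighbors of $u$. $D$ is strongly extensive if for every vertex $u\in V$ and every set $A\subseteq N(u)$ there exists a vertex $v\in V$ such that $N(v)=A$. "Countable" here means infinite countable. -}

module Defs where

open import Data.List.Base using (List)
open import Data.List.Membership.Propositional using (_∈_)
open import Data.Nat.Base using (ℕ)
open import Data.Product.Base using (∃-syntax)
open import Function.Bundles using (_↔_)
open import Level using (Level; suc; _⊔_)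
open import Relation.Binary.Core using (Rel)
open import Relation.Unary using (Pred; _⊆_; _≐_)

private
  variable
    a ℓ : Level

record Digraph (v e : Level) : Set (suc (v ⊔ e)) where
  field
    V        : Set v
    nonempty : V
    E        : Rel V e

  -- In-neighbours of u; subsets of V are predicates, equal when extensionally
  -- equal (_≐_).
  N : V → Pred V e
  N u v = E v u

-- The list may contain repetitions.
Finite : {A : Set a} → Pred A ℓ → Set (a ⊔ ℓ)
Finite {A = A} P = ∃[ xs ] P ≐ (λ (x : A) → x ∈ xs)

-- "Countable" means infinite countable.
Countable : Set a → Set a
Countable A = A ↔ ℕ

-- A ranges over all predicates, decidable or not.  If V is countable and every
-- N u is finite then membership in N v is decidable, so for such a digraph
-- with an edge this property can only be obtained using excluded middle.
StronglyExtensive : ∀ {v e} → Digraph v e → Set (v ⊔ suc e)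
StronglyExtensive {e = e} D =
  ∀ (u : V) (A : Pred V e) → A ⊆ N u → ∃[ v ] N v ≐ A
  where open Digraph D

{-# OPTIONS --safe #-}
-- Any surjection from ℕ onto the finite lists over ℕ gives such a digraph: let
-- the in-neighbours of u be the entries of the u-th list.  The surjection used
-- here inverts the coding [] ↦ 0, x ∷ xs ↦ 2 ^ x * (2 * code xs + 1).
module Submission where

open import Axiom.ExcludedMiddle using (ExcludedMiddle)
open import Data.List.Base using (List; []; _∷_; filter)
open import Data.List.Membership.Propositional using (_∈_)
open import Data.List.Membership.Propositional.Properties using (∈-filter⁺; ∈-filter⁻)
open import Data.Nat.Base using (ℕ; zero; suc; _*_)
open import Data.Product.Base using (Σ-syntax; ∃-syntax; _×_; _,_; proj₂)
open import Function.Construct.Identity using (↔-id)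
open import Level using (Level; 0ℓ)
open import Relation.Binary.PropositionalEquality using (_≡_; refl; cong; module ≡-Reasoning)
open import Relation.Unary using (Pred; Decidable; _⊆_; _≐_)
open import Relation.Unary.Properties using (≐-refl)
open import Defs

private
  variable
    a p q : Level

-- Doubling, transported along the coding; `[]` is fixed because its code is 0.
sucHead : List ℕ → List ℕ
sucHead []       = []
sucHead (x ∷ xs) = suc x ∷ xs

-- The successor of ℕ, transported to lists along the coding.
next : List ℕ → List ℕ
next []           = 0 ∷ []
-- With `c` the code of `xs`, the successor of the odd code 2c + 1 is 2(c + 1).
next (zero  ∷ xs) = sucHead (next xs)
-- An even code 2m, with m the code of `x ∷ xs`, is followed by 2m + 1.
next (suc x ∷ xs) = 0 ∷ x ∷ xs

decode : ℕ → List ℕ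
decode zero    = []
decode (suc n) = next (decode n)

next-sucHead : ∀ xs → next (sucHead xs) ≡ 0 ∷ xs
next-sucHead []       = refl
next-sucHead (x ∷ xs) = refl

decode-even : ∀ n → decode (n * 2) ≡ sucHead (decode n)
decode-even zero    = refl
decode-even (suc n) = begin
  next (next (decode (n * 2)))        ≡⟨ cong (λ xs → next (next xs)) (decode-even n) ⟩
  next (next (sucHead (decode n)))    ≡⟨ cong next (next-sucHead (decode n)) ⟩
  -- Reached by computation: `next` on a list with head 0.
  sucHead (next (decode n))           ∎
  where open ≡-Reasoning

decode-odd : ∀ n → decode (suc (n * 2)) ≡ 0 ∷ decode n
decode-odd n = begin
  next (decode (n * 2))       ≡⟨ cong next (decode-even n) ⟩
  next (sucHead (decode n))   ≡⟨ next-sucHead (decode n) ⟩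
  0 ∷ decode n                ∎
  where open ≡-Reasoning

-- The witness is 2 ^ x * (2 * n + 1): the odd number coding head 0, doubled `x` times.
decode-∷ : ∀ x n → ∃[ m ] decode m ≡ x ∷ decode n
decode-∷ zero    n = suc (n * 2) , decode-odd n
decode-∷ (suc x) n with m , eq ← decode-∷ x n = m * 2 , (begin
  decode (m * 2)         ≡⟨ decode-even m ⟩
  sucHead (decode m)     ≡⟨ cong sucHead eq ⟩
  suc x ∷ decode n       ∎)
  where open ≡-Reasoning

decode-surjective : ∀ xs → ∃[ n ] decode n ≡ xs
decode-surjective []       = 0 , refl
decode-surjective (x ∷ xs) with n , refl ← decode-surjective xs = decode-∷ x n

-- Filtering a list for `Q` by `P?` lists `P`; this is why `P` has to be decidable.
finite-⊆ : {A : Set a} {P : Pred A p} {Q : Pred A q} →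
           Decidable P → P ⊆ Q → Finite Q → Finite P
finite-⊆ P? P⊆Q (xs , Q⊆xs , _) =
  filter P? xs ,
  (λ Px → ∈-filter⁺ P? (Q⊆xs (P⊆Q Px)) Px) ,
  (λ x∈ → proj₂ (∈-filter⁻ P? {xs = xs} x∈))

listDigraph : Digraph 0ℓ 0ℓ
listDigraph = record
  { V        = ℕ
  ; nonempty = 0
  ; E        = λ v u → v ∈ decode u
  }

N-finite : ∀ u → Finite (Digraph.N listDigraph u)
N-finite u = decode u , ≐-refl

N-surjective : ∀ (A : Pred ℕ 0ℓ) → Finite A → ∃[ u ] Digraph.N listDigraph u ≐ A
-- Once `xs` is `decode u`, `N u` is membership in `xs`, so the two inclusions only swap places.
N-surjective A (xs , A⊆xs , xs⊆A) with u , refl ← decode-surjective xs = u , xs⊆A , A⊆xs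

proposition6p5 : Σ[ D ∈ Digraph 0ℓ 0ℓ ]
    (let open Digraph D in
    Countable V
    × (∀ (u : V) → Finite (N u))
    × (∀ (A : Pred V 0ℓ) → Finite A → ∃[ u ] N u ≐ A)
    × (ExcludedMiddle 0ℓ → StronglyExtensive D))
proposition6p5 =
  listDigraph , ↔-id ℕ , N-finite , N-surjective ,
  -- Excluded middle serves only to decide the arbitrary predicate `A`, making it finite.
  λ em u A A⊆Nu → N-surjective A (finite-⊆ (λ _ → em) A⊆Nu (N-finite u))
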